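{- Let $A=(a_{ij})_{1\leq i\leq h,\,1\leq j\leq k}$ be an $h\times k$ matrix with integer entries and let $M=\max_{1\leq i\leq h,\,1\leq j\leq k}|a_{ij}|$. Assume that each two rows of $A$ are linearly independent. Then there exists a non-singular matrix $T\in\mathbb{Z}^{k\times k}$ such that $|c_{11}|,|c_{21}|,\ldots,|c_{h1}|$ are distinct positive integers bounded by $h^4M$, where the $c_{ij}$ are given by $$(c_{ij})_{1\leq i\leq h,\,1\leq j\leq k}=(a_{ij})_{1\leq i\leq h,\,1\leq j\leq k}\,T.$$
   Context: Non-singular means $\det T\neq0$. "Each two rows" refers to any two rows with distinct indices.
   Formalization: When h = 1 the formal statement additionally assumes that A has a nonzero entry, because for a single zero row the independence assumption is vacuous and c_11 = 0 for every T, so the claim fails. -}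

module Defs where

open import Algebra.Properties.Semiring.Sum using (sum)
open import Data.Fin.Base using (zero; toℕ)
open import Data.Integer.Base using (ℤ; 0ℤ; 1ℤ; -1ℤ; _*_; _^_; ∣_∣)
open import Data.Integer.Properties using (+-*-semiring)
open import Data.Nat.Base using (ℕ; zero; suc; _⊔_)
open import Data.Vec.Functional using (Vector; []; _∷_; foldr; map; removeAt; tail)
open import Relation.Binary.PropositionalEquality using (_≡_; _≢_)

Matrix : ℕ → ℕ → Set
Matrix h k = Vector (Vector ℤ k) h

∑ : ∀ {n} → Vector ℤ n → ℤ
∑ = sum +-*-semiring

infixl 7 _⊗_

_⊗_ : ∀ {h k l} → Matrix h k → Matrix k l → Matrix h l
(A ⊗ B) i j = ∑ (λ p → A i p * B p j)

-- Laplace expansion along the first row.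
det : ∀ {n} → Matrix n n → ℤ
det {zero}  T = 1ℤ
det {suc n} T =
  ∑ (λ j → -1ℤ ^ toℕ j * T zero j * det (map (λ row → removeAt row j) (tail T)))

NonSingular : ∀ {n} → Matrix n n → Set
NonSingular T = det T ≢ 0ℤ

-- Independence over ℤ; for integer vectors this agrees with independence
-- over ℚ or ℝ, since a rational relation can be cleared of denominators.
LinearlyIndependent : ∀ {m k} → Vector (Vector ℤ k) m → Set
LinearlyIndependent {m} v =
  (c : Vector ℤ m) → (∀ j → ∑ (λ i → c i * v i j) ≡ 0ℤ) → ∀ i → c i ≡ 0ℤ

EachTwoRowsIndependent : ∀ {h k} → Matrix h k → Set
EachTwoRowsIndependent A =
  ∀ i i′ → i ≢ i′ → LinearlyIndependent (A i ∷ A i′ ∷ [])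

maximum : ∀ {n} → Vector ℕ n → ℕ
maximum = foldr _⊔_ 0

maxAbs : ∀ {h k} → Matrix h k → ℕ
maxAbs A = maximum (λ i → maximum (λ j → ∣ A i j ∣))

{-# OPTIONS --safe #-}
module Submission where

-- The first column t of T only has to be non-orthogonal to the h² nonzero
-- vectors A i (all i), A i + A j (i < j) and A i − A j (i > j).  Such a t with
-- natural entries of total at most h² is chosen one coordinate at a time: the
-- coordinate is fixed after all later ones, it only has to serve the vectors
-- whose first nonzero entry sits there, and each of them forbids at most one
-- value.  Hence ∣A i · t∣ ≤ h² M ≤ h⁴ M.

open import Defs
open import Algebra.Properties.Semiring.Sum using (sum-cong-≗; sum-replicate-zero; sum-remove; ∑-distrib-+; *-distribˡ-sum)
open import Data.Empty using (⊥-elim)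
open import Data.Fin.Base as Fin using (Fin; zero; suc; toℕ; punchIn)
open import Data.Fin.Properties as Fin using (punchInᵢ≢i; toℕ<n; pigeonhole; ¬∀⟶∃¬)
open import Data.Integer.Base as ℤ using (ℤ; +_; -[1+_]; 0ℤ; 1ℤ; -1ℤ; ∣_∣)
open import Data.Integer.Properties as ℤ using (+-*-semiring)
open import Data.Integer.Tactic.RingSolver using (solve-∀)
open import Data.List.Base as List using (List; length; filter; allFin; cartesianProductWith)
open import Data.List.Membership.Propositional using (_∈_; lose)
open import Data.List.Membership.Propositional.Properties using (∈-map⁺; ∈-map⁻; ∈-filter⁺; ∈-filter⁻; ∈-allFin; ∈-cartesianProductWith⁺; ∈-cartesianProductWith⁻; ∈-lookup)
open import Data.List.Properties using (length-map; length-++; length-tabulate)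
open import Data.List.Relation.Unary.Any using (Any; any?; index)
open import Data.List.Relation.Unary.Any.Properties using (lookup-index)
open import Data.Nat.Base using (ℕ; zero; suc; _+_; _*_; _^_; _≤_; _<_; z≤n; s≤s; s≤s⁻¹)
open import Data.Nat.Properties as ℕ using (module ≤-Reasoning)
open import Data.Product.Base using (Σ-syntax; ∃; ∃₂; _×_; _,_; proj₂)
open import Data.Sum.Base using (_⊎_; inj₁; inj₂; [_,_]′)
open import Data.Vec.Functional using (Vector; []; _∷_; foldr; map; removeAt; tail)
open import Function.Base using (_∘_; id)
open import Function.Definitions using (Injective)
open import Level using (Level)
open import Relation.Binary.Definitions using (Decidable; tri<; tri≈; tri>)
open import Relation.Binary.PropositionalEquality using (_≡_; _≢_; refl; sym; trans; cong; cong₂; subst; module ≡-Reasoning)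
open import Relation.Nullary using (¬_; yes; no; contradiction)
open import Relation.Unary as Unary using (Pred)
open import Relation.Unary.Properties using (∁?)

private
  variable
    a p r : Level
    n k h : ℕ

-- Products of integer vectors with natural vectors, and their size.

NonZeroVector : Vector ℤ n → Set
NonZeroVector v = ¬ (∀ p → v p ≡ 0ℤ)

total : Vector ℕ n → ℕ
total = foldr _+_ 0

infix 8 _·_

_·_ : Vector ℤ n → Vector ℕ n → ℤ
v · t = ∑ (λ p → v p ℤ.* + t p)

∑-zero : (v : Vector ℤ n) → (∀ p → v p ≡ 0ℤ) → ∑ v ≡ 0ℤ
∑-zero {n} v v≡0 = trans (sum-cong-≗ +-*-semiring v≡0) (sum-replicate-zero +-*-semiring n)

-- Stated with a scalar `s` so that one identity covers a row, a sum of rows and a difference of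
-- rows, for `s` equal to 0, 1 and -1.
·-linear : ∀ (s : ℤ) (u v : Vector ℤ n) t →
           (λ p → u p ℤ.+ s ℤ.* v p) · t ≡ u · t ℤ.+ s ℤ.* v · t
·-linear s u v t = begin
  ∑ (λ p → (u p ℤ.+ s ℤ.* v p) ℤ.* + t p)
    ≡⟨ sum-cong-≗ +-*-semiring (λ p → expand s (u p) (v p) (+ t p)) ⟩
  ∑ (λ p → u p ℤ.* + t p ℤ.+ s ℤ.* (v p ℤ.* + t p))
    ≡⟨ ∑-distrib-+ +-*-semiring (λ p → u p ℤ.* + t p) (λ p → s ℤ.* (v p ℤ.* + t p)) ⟩
  u · t ℤ.+ ∑ (λ p → s ℤ.* (v p ℤ.* + t p))
    ≡⟨ cong (λ x → u · t ℤ.+ x) (sym (*-distribˡ-sum +-*-semiring s (λ p → v p ℤ.* + t p))) ⟩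
  u · t ℤ.+ s ℤ.* v · t ∎
  where
  open ≡-Reasoning
  expand : ∀ s x y z → (x ℤ.+ s ℤ.* y) ℤ.* z ≡ x ℤ.* z ℤ.+ s ℤ.* (y ℤ.* z)
  expand = solve-∀

-- Triangle inequality; as the entries of `t` are natural, their sum is the whole weight put on `m`.
∣·∣≤total : ∀ (v : Vector ℤ n) t m → (∀ p → ∣ v p ∣ ≤ m) → ∣ v · t ∣ ≤ total t * m
∣·∣≤total {zero}  v t m v≤m = z≤n
∣·∣≤total {suc n} v t m v≤m = begin
  ∣ v zero ℤ.* + t zero ℤ.+ tail v · tail t ∣
    ≤⟨ ℤ.∣i+j∣≤∣i∣+∣j∣ (v zero ℤ.* + t zero) (tail v · tail t) ⟩
  ∣ v zero ℤ.* + t zero ∣ + ∣ tail v · tail t ∣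
    ≡⟨ cong (_+ ∣ tail v · tail t ∣) (trans (ℤ.abs-* (v zero) (+ t zero)) (ℕ.*-comm ∣ v zero ∣ (t zero))) ⟩
  t zero * ∣ v zero ∣ + ∣ tail v · tail t ∣
    ≤⟨ ℕ.+-mono-≤ (ℕ.*-monoʳ-≤ (t zero) (v≤m zero)) (∣·∣≤total (tail v) (tail t) m (v≤m ∘ suc)) ⟩
  t zero * m + total (tail t) * m
    ≡⟨ ℕ.*-distribʳ-+ m (t zero) (total (tail t)) ⟨
  total t * m ∎
  where open ≤-Reasoning

≤maximum : ∀ (v : Vector ℕ n) p → v p ≤ maximum v
≤maximum v zero    = ℕ.m≤m⊔n _ _
≤maximum v (suc p) = ℕ.≤-trans (≤maximum (tail v) p) (ℕ.m≤n⊔m (v zero) _)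

≤maxAbs : ∀ (A : Matrix h k) i j → ∣ A i j ∣ ≤ maxAbs A
≤maxAbs A i j = ℕ.≤-trans (≤maximum (λ j → ∣ A i j ∣) j) (≤maximum (λ i → maximum (λ j → ∣ A i j ∣)) i)

-- Counting in lists and a pigeonhole argument.

length-filter-∁ : ∀ {A : Set a} {P : Pred A p} (P? : Unary.Decidable P) xs →
                  length (filter (∁? P?) xs) + length (filter P? xs) ≡ length xs
length-filter-∁ P? List.[] = refl
length-filter-∁ P? (x List.∷ xs) with P? x
... | yes _ = trans (ℕ.+-suc _ _) (cong suc (length-filter-∁ P? xs))
... | no  _ = cong suc (length-filter-∁ P? xs)

length-cartesianProductWith : ∀ {A B C : Set a} (f : A → B → C) xs ys →
                              length (cartesianProductWith f xs ys) ≡ length xs * length ys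
length-cartesianProductWith f List.[]         ys = refl
length-cartesianProductWith f (x List.∷ xs) ys =
  trans (length-++ (List.map (f x) ys))
        (cong₂ _+_ (length-map (f x) ys) (length-cartesianProductWith f xs ys))

-- Read `R x v` as "`v` forbids `x`". If all `suc (length xs)` candidates from 0 to `length xs` were
-- forbidden, two of them would be forbidden by the entry at one and the same list position, against
-- uniqueness.
escape : ∀ {A : Set a} {R : ℕ → A → Set r} → Decidable R → ∀ xs →
         (∀ {v} → v ∈ xs → ∀ {x y} → R x v → R y v → x ≡ y) →
         ∃ λ x → x ≤ length xs × (∀ {v} → v ∈ xs → ¬ R x v)
escape {R = R} R? xs unique =
  let x , ¬hit = ¬∀⟶∃¬ (suc (length xs)) Hit hit? ¬allHit
  in toℕ x , s≤s⁻¹ (toℕ<n x) , λ v∈xs Rxv → ¬hit (lose v∈xs Rxv)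
  where
  Hit : Fin (suc (length xs)) → Set _
  Hit x = Any (R (toℕ x)) xs

  hit? : Unary.Decidable Hit
  hit? x = any? (R? (toℕ x)) xs

  ¬allHit : ¬ (∀ x → Hit x)
  ¬allHit hit with x , y , x<y , eq ← pigeonhole ℕ.≤-refl (index ∘ hit) =
    ℕ.<⇒≢ x<y (unique (∈-lookup (index (hit y)))
      (subst (R (toℕ x) ∘ List.lookup xs) eq (lookup-index (hit x)))
      (lookup-index (hit y)))

-- Subtracting the equations leaves b(x - y) = 0. Hence a vector with nonzero head forbids at most
-- one value of the first coordinate.
affine-injective : ∀ b c {x y} → b ≢ 0ℤ → b ℤ.* + x ℤ.+ c ≡ 0ℤ → b ℤ.* + y ℤ.+ c ≡ 0ℤ → x ≡ y
affine-injective b c {x} {y} b≢0 eqx eqy =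
  [ (λ b≡0 → contradiction b≡0 b≢0) , ℤ.+-injective ∘ ℤ.i-j≡0⇒i≡j (+ x) (+ y) ]′
    (ℤ.i*j≡0⇒i≡0∨j≡0 b (trans (difference b c (+ x) (+ y)) (cong₂ ℤ._-_ eqx eqy)))
  where
  difference : ∀ b c x y → b ℤ.* (x ℤ.- y) ≡ (b ℤ.* x ℤ.+ c) ℤ.- (b ℤ.* y ℤ.+ c)
  difference = solve-∀

-- Small natural vectors off finitely many hyperplanes.

headZero? : Unary.Decidable (λ (v : Vector ℤ (suc k)) → v zero ≡ 0ℤ)
headZero? v = v zero ℤ.≟ 0ℤ

-- The sum of the entries is bounded, not each entry: the bounds for the two halves of a split list
-- then add up to the length of the whole.
Avoiding : List (Vector ℤ k) → Vector ℕ k → Set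
Avoiding vs t = total t ≤ length vs × (∀ {v} → v ∈ vs → v · t ≢ 0ℤ)

-- A vector with zero head has the same product with `x ∷ t` as its tail has with `t`, so `t` takes
-- care of it; the others are left to `x`.
prepend-avoiding : ∀ (vs : List (Vector ℤ (suc k))) t x →
                   Avoiding (List.map tail (filter headZero? vs)) t →
                   x ≤ length (filter (∁? headZero?) vs) →
                   (∀ {v} → v ∈ filter (∁? headZero?) vs → v zero ℤ.* + x ℤ.+ tail v · t ≢ 0ℤ) →
                   Avoiding vs (x ∷ t)
prepend-avoiding vs t x (t≤ , avoids) x≤ escapes = bound , avoids′
  where
  bound : x + total t ≤ length vs
  bound = begin
    x + total t
      ≤⟨ ℕ.+-mono-≤ x≤ (ℕ.≤-trans t≤ (ℕ.≤-reflexive (length-map tail (filter headZero? vs)))) ⟩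
    length (filter (∁? headZero?) vs) + length (filter headZero? vs)
      ≡⟨ length-filter-∁ headZero? vs ⟩
    length vs ∎
    where open ≤-Reasoning

  avoids′ : ∀ {v} → v ∈ vs → v · (x ∷ t) ≢ 0ℤ
  avoids′ {v} v∈vs v·≡0 with v zero ℤ.≟ 0ℤ
  ... | no  v₀≢0 = escapes (∈-filter⁺ (∁? headZero?) v∈vs v₀≢0) v·≡0
  ... | yes v₀≡0 = avoids (∈-map⁺ tail (∈-filter⁺ headZero? v∈vs v₀≡0)) (begin
    tail v · t                         ≡⟨ ℤ.+-identityˡ _ ⟨
    0ℤ ℤ.* + x ℤ.+ tail v · t          ≡⟨ cong (λ c → c ℤ.* + x ℤ.+ tail v · t) v₀≡0 ⟨
    v zero ℤ.* + x ℤ.+ tail v · t      ≡⟨ v·≡0 ⟩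
    0ℤ ∎)
    where open ≡-Reasoning

avoidHyperplanes : ∀ (vs : List (Vector ℤ k)) → (∀ {v} → v ∈ vs → NonZeroVector v) →
                   ∃ (Avoiding vs)
-- In dimension zero every vector is zero, so `vs` has no members.
avoidHyperplanes {zero}  vs nonZero = [] , z≤n , λ v∈vs _ → nonZero v∈vs λ ()
avoidHyperplanes {suc k} vs nonZero =
  let t , t-avoids = avoidHyperplanes (List.map tail (filter headZero? vs)) tails-nonZero
      x , x≤ , escapes = choose t
  in x ∷ t , prepend-avoiding vs t x t-avoids x≤ escapes
  where
  tails-nonZero : ∀ {u} → u ∈ List.map tail (filter headZero? vs) → NonZeroVector u
  tails-nonZero u∈ u≡0 with v , v∈ , refl ← ∈-map⁻ tail u∈ with v∈vs , v₀≡0 ← ∈-filter⁻ headZero? {xs = vs} v∈ =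
    nonZero v∈vs λ { zero → v₀≡0 ; (suc p) → u≡0 p }

  choose : ∀ t → ∃ λ x → x ≤ length (filter (∁? headZero?) vs) ×
           (∀ {v} → v ∈ filter (∁? headZero?) vs → v zero ℤ.* + x ℤ.+ tail v · t ≢ 0ℤ)
  choose t = escape (λ x v → v zero ℤ.* + x ℤ.+ tail v · t ℤ.≟ 0ℤ) (filter (∁? headZero?) vs)
    (λ {v} v∈ → affine-injective (v zero) (tail v · t) (proj₂ (∈-filter⁻ (∁? headZero?) {xs = vs} v∈)))

-- Determinants, and completing a vector to a non-singular matrix.

minor : Matrix (suc n) (suc n) → Fin (suc n) → Matrix n n
minor T j = map (λ row → removeAt row j) (tail T)

det-cong : ∀ {S T : Matrix n n} → (∀ i j → S i j ≡ T i j) → det S ≡ det T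
det-cong {zero}  S≗T = refl
det-cong {suc n} S≗T = sum-cong-≗ +-*-semiring λ j →
  cong₂ ℤ._*_ (cong (-1ℤ ℤ.^ toℕ j ℤ.*_) (S≗T zero j))
              (det-cong λ i l → S≗T (suc i) (punchIn j l))

*-nonZero : ∀ {x y} → x ≢ 0ℤ → y ≢ 0ℤ → x ℤ.* y ≢ 0ℤ
*-nonZero {x} x≢0 y≢0 xy≡0 = [ x≢0 , y≢0 ]′ (ℤ.i*j≡0⇒i≡0∨j≡0 x xy≡0)

-- The Laplace expansion collapses to the term at `q`, a product of a sign, the pivot and `det S`.
-- The minor is compared with `S` entrywise because matrices are functions.
nonSingular-expand : ∀ (T : Matrix (suc n) (suc n)) q {S} → T zero q ≢ 0ℤ →
                     (∀ j → T zero (punchIn q j) ≡ 0ℤ) →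
                     (∀ i j → minor T q i j ≡ S i j) → NonSingular S → NonSingular T
nonSingular-expand T q {S} pivot≢0 rest≡0 minor≗S det≢0 det≡0 =
  *-nonZero (*-nonZero sign≢0 pivot≢0) (det≢0 ∘ trans (sym (det-cong minor≗S))) (begin
    term q                                   ≡⟨ ℤ.+-identityʳ (term q) ⟨
    term q ℤ.+ 0ℤ                            ≡⟨ cong (λ x → term q ℤ.+ x) (∑-zero (removeAt term q) others≡0) ⟨
    term q ℤ.+ ∑ (removeAt term q)           ≡⟨ sum-remove +-*-semiring {i = q} term ⟨
    det T                                    ≡⟨ det≡0 ⟩
    0ℤ ∎)
  where
  open ≡-Reasoning
  term : Vector ℤ _
  term j = -1ℤ ℤ.^ toℕ j ℤ.* T zero j ℤ.* det (minor T j)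

  sign≢0 : -1ℤ ℤ.^ toℕ q ≢ 0ℤ
  sign≢0 eq = contradiction (ℤ.i^n≡0⇒i≡0 -1ℤ (toℕ q) eq) λ ()

  others≡0 : ∀ j → removeAt term q j ≡ 0ℤ
  others≡0 j = begin
    s ℤ.* T zero j′ ℤ.* d ≡⟨ cong (λ x → s ℤ.* x ℤ.* d) (rest≡0 j) ⟩
    s ℤ.* 0ℤ ℤ.* d        ≡⟨ cong (ℤ._* d) (ℤ.*-zeroʳ s) ⟩
    0ℤ ∎
    where
    j′ = punchIn q j
    s = -1ℤ ℤ.^ toℕ j′
    d = det (minor T j′)

identity : Matrix n n
identity zero    zero    = 1ℤ
identity zero    (suc j) = 0ℤ
identity (suc i) zero    = 0ℤ
identity (suc i) (suc j) = identity i j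

identity-nonSingular : ∀ n → NonSingular (identity {n})
identity-nonSingular zero    = λ ()
identity-nonSingular (suc n) =
  nonSingular-expand {n} identity zero {identity} (λ ()) (λ _ → refl) (λ _ _ → refl) (identity-nonSingular n)

-- Abstract, as is separatingVector: unfolding the constructions makes checking
-- lemma1 intractable.
abstract
  extendColumn : ∀ (t : Vector ℤ (suc n)) →
                 Σ[ T ∈ Matrix (suc n) (suc n) ]
                   (NonSingular T × (NonZeroVector t → ∀ i → T i zero ≡ t i))
  extendColumn {n} t with t zero ℤ.≟ 0ℤ
  -- The nonzero head serves as pivot; `T` is lower triangular with ones on the rest of the
  -- diagonal.
  ... | no t₀≢0 =
    T , nonSingular-expand T zero {identity} t₀≢0 (λ _ → refl) (λ _ _ → refl) (identity-nonSingular n) , λ _ _ → refl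
    where
    T : Matrix (suc n) (suc n)
    T i       zero    = t i
    T zero    (suc j) = 0ℤ
    T (suc i) (suc j) = identity i j
  -- Here `t` is zero and cannot be the column of a non-singular matrix; the identity is a default
  -- value.
  extendColumn {zero}  t | yes t₀≡0 =
    identity , identity-nonSingular 1 , λ t≢0 → ⊥-elim (t≢0 λ { zero → t₀≡0 })
  -- With a zero head the pivot 1 moves to the second column; deleting it with the first row leaves
  -- `S`, which carries `tail t`.
  extendColumn {suc n} t | yes t₀≡0 with S , S-nonSingular , S-column ← extendColumn (tail t)
    = T , nonSingular-expand T (suc zero) {S} (λ ()) rest≡0 minor≗S S-nonSingular , column
    where
    T : Matrix (suc (suc n)) (suc (suc n))
    T zero    (suc zero)    = 1ℤ
    T zero    _             = 0ℤ
    T (suc i) zero          = S i zero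
    T (suc i) (suc zero)    = 0ℤ
    T (suc i) (suc (suc j)) = S i (suc j)

    rest≡0 : ∀ j → T zero (punchIn (suc zero) j) ≡ 0ℤ
    rest≡0 zero    = refl
    rest≡0 (suc j) = refl

    minor≗S : ∀ i j → minor T (suc zero) i j ≡ S i j
    minor≗S i zero    = refl
    minor≗S i (suc j) = refl

    column : NonZeroVector t → ∀ i → T i zero ≡ t i
    column t≢0 zero    = sym t₀≡0
    column t≢0 (suc i) = S-column (λ tail≡0 → t≢0 λ { zero → t₀≡0 ; (suc p) → tail≡0 p }) i

-- The combinations of rows to be avoided.

orderSign : Fin h → Fin h → ℤ
orderSign i j with Fin.<-cmp i j
... | tri< _ _ _ = 1ℤ
... | tri≈ _ _ _ = 0ℤ
... | tri> _ _ _ = -1ℤ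

orderSign-refl : ∀ (i : Fin h) → orderSign i i ≡ 0ℤ
orderSign-refl i with Fin.<-cmp i i
... | tri< _ i≢i _ = contradiction refl i≢i
... | tri≈ _ _ _   = refl
... | tri> _ i≢i _ = contradiction refl i≢i

orderSign-< : ∀ {i j : Fin h} → i Fin.< j → orderSign i j ≡ 1ℤ
orderSign-< {i = i} {j} i<j with Fin.<-cmp i j
... | tri< _ _ _   = refl
... | tri≈ i≮j _ _ = contradiction i<j i≮j
... | tri> i≮j _ _ = contradiction i<j i≮j

orderSign-> : ∀ {i j : Fin h} → j Fin.< i → orderSign i j ≡ -1ℤ
orderSign-> {i = i} {j} j<i with Fin.<-cmp i j
... | tri< _ _ j≮i = contradiction j<i j≮i
... | tri≈ _ _ j≮i = contradiction j<i j≮i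
... | tri> _ _ _   = refl

-- The sign lets one formula over all h² index pairs produce the rows on the diagonal, the sums
-- above it and the differences below it.
combination : Matrix h k → Fin h → Fin h → Vector ℤ k
combination A i j p = A i p ℤ.+ orderSign i j ℤ.* A j p

-- Next to any second row, a zero row would satisfy the relation with coefficients 1 and 0. A single
-- row has no partner, and there the nonzero entry is used.
row-nonZero : ∀ (A : Matrix h k) → EachTwoRowsIndependent A →
              (h ≡ 1 → ∃₂ λ i j → A i j ≢ 0ℤ) → ∀ i → NonZeroVector (A i)
row-nonZero {suc zero} A indep nonZero zero Ai≡0 with nonZero refl
... | zero , j , Aij≢0 = Aij≢0 (Ai≡0 j)
row-nonZero {suc (suc h)} A indep _ i Ai≡0 =
  contradiction (indep i (punchIn i zero) (punchInᵢ≢i i zero ∘ sym) (1ℤ ∷ 0ℤ ∷ []) relation zero) λ ()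
  where
  relation : ∀ j → 1ℤ ℤ.* A i j ℤ.+ (0ℤ ℤ.+ 0ℤ) ≡ 0ℤ
  relation j = cong (λ x → 1ℤ ℤ.* x ℤ.+ 0ℤ) (Ai≡0 j)

combination-nonZero : ∀ (A : Matrix h k) → EachTwoRowsIndependent A →
                      (∀ i → NonZeroVector (A i)) → ∀ i j → NonZeroVector (combination A i j)
combination-nonZero A indep rows≢0 i j c≡0 with i Fin.≟ j
... | yes refl = rows≢0 i λ p → begin
  A i p                              ≡⟨ ℤ.+-identityʳ (A i p) ⟨
  A i p ℤ.+ 0ℤ ℤ.* A i p             ≡⟨ cong (λ s → A i p ℤ.+ s ℤ.* A i p) (orderSign-refl i) ⟨
  A i p ℤ.+ orderSign i i ℤ.* A i p  ≡⟨ c≡0 p ⟩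
  0ℤ ∎
  where open ≡-Reasoning
... | no i≢j = contradiction (indep i j i≢j (1ℤ ∷ orderSign i j ∷ []) (λ p → trans (simplify (orderSign i j) (A i p) (A j p)) (c≡0 p)) zero) λ ()
  where
  simplify : ∀ s x y → 1ℤ ℤ.* x ℤ.+ (s ℤ.* y ℤ.+ 0ℤ) ≡ x ℤ.+ s ℤ.* y
  simplify = solve-∀

-- Equal absolute values force x = -y or x = y. The two assumptions have the shape given by the
-- pairs (i, j) and (j, i) with i < j.
∣∣-distinct : ∀ x y → x ℤ.+ 1ℤ ℤ.* y ≢ 0ℤ → y ℤ.+ -1ℤ ℤ.* x ≢ 0ℤ → ∣ x ∣ ≢ ∣ y ∣
∣∣-distinct x y sum≢0 diff≢0 ∣x∣≡∣y∣ = [ sum≢0 , diff≢0 ]′ (cases x y ∣x∣≡∣y∣)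
  where
  cancel₁ : ∀ z → (ℤ.- z) ℤ.+ 1ℤ ℤ.* z ≡ 0ℤ
  cancel₁ = solve-∀
  cancel₂ : ∀ z → z ℤ.+ 1ℤ ℤ.* (ℤ.- z) ≡ 0ℤ
  cancel₂ = solve-∀
  cancel₃ : ∀ z → z ℤ.+ -1ℤ ℤ.* z ≡ 0ℤ
  cancel₃ = solve-∀
  cases : ∀ x y → ∣ x ∣ ≡ ∣ y ∣ → x ℤ.+ 1ℤ ℤ.* y ≡ 0ℤ ⊎ y ℤ.+ -1ℤ ℤ.* x ≡ 0ℤ
  cases (+ m)    (+ m)    refl = inj₂ (cancel₃ (+ m))
  cases (+ _)    -[1+ n ] refl = inj₁ (cancel₂ (+ suc n))
  cases -[1+ m ] (+ _)    refl = inj₁ (cancel₁ (+ suc m))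
  cases -[1+ m ] -[1+ m ] refl = inj₂ (cancel₃ -[1+ m ])

combinations : Matrix h k → List (Vector ℤ k)
combinations {h} A = cartesianProductWith (combination A) (allFin h) (allFin h)

length-combinations : ∀ (A : Matrix h k) → length (combinations A) ≡ h * h
length-combinations {h} A =
  trans (length-cartesianProductWith (combination A) (allFin h) (allFin h))
        (cong (λ m → m * m) (length-tabulate {n = h} id))

module _ (A : Matrix h k) (t : Vector ℕ k) (avoids : ∀ {v} → v ∈ combinations A → v · t ≢ 0ℤ) where

  private
    avoid : ∀ i j s → orderSign i j ≡ s → A i · t ℤ.+ s ℤ.* A j · t ≢ 0ℤ
    avoid i j s refl eq =
      avoids (∈-cartesianProductWith⁺ (combination A) (∈-allFin i) (∈-allFin j))
             (trans (·-linear (orderSign i j) (A i) (A j) t) eq)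

    distinct : ∀ i j → i Fin.< j → ∣ A i · t ∣ ≢ ∣ A j · t ∣
    distinct i j i<j =
      ∣∣-distinct (A i · t) (A j · t) (avoid i j 1ℤ (orderSign-< i<j)) (avoid j i -1ℤ (orderSign-> i<j))

  rows·t≢0 : ∀ i → A i · t ≢ 0ℤ
  rows·t≢0 i eq = avoid i i 0ℤ (orderSign-refl i) (trans (ℤ.+-identityʳ (A i · t)) eq)

  ∣rows·t∣-injective : Injective _≡_ _≡_ (λ i → ∣ A i · t ∣)
  ∣rows·t∣-injective {i} {j} eq with Fin.<-cmp i j
  ... | tri< i<j _ _ = contradiction eq (distinct i j i<j)
  ... | tri≈ _ i≡j _ = i≡j
  ... | tri> _ _ j<i = contradiction (sym eq) (distinct j i j<i)

abstract
  separatingVector : ∀ (A : Matrix h k) → EachTwoRowsIndependent A →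
                     (h ≡ 1 → ∃₂ λ i j → A i j ≢ 0ℤ) →
                     Σ[ t ∈ Vector ℕ k ] (total t ≤ h * h × (∀ i → A i · t ≢ 0ℤ) ×
                                          Injective _≡_ _≡_ (λ i → ∣ A i · t ∣))
  separatingVector {h} A indep nonZero =
    let t , t≤ , avoids = avoidHyperplanes (combinations A) combinations-nonZero
    in t , subst (total t ≤_) (length-combinations A) t≤ , rows·t≢0 A t avoids , ∣rows·t∣-injective A t avoids
    where
    combinations-nonZero : ∀ {v} → v ∈ combinations A → NonZeroVector v
    combinations-nonZero v∈
      with i , j , _ , _ , refl ← ∈-cartesianProductWith⁻ (combination A) (allFin h) (allFin h) v∈
      = combination-nonZero A indep (row-nonZero A indep nonZero) i j

-- The final bound and the assembly of the matrix.

n*n≤n^4 : ∀ n → n * n ≤ n ^ 4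
n*n≤n^4 zero      = z≤n
n*n≤n^4 n@(suc _) = begin
  n * n   ≡⟨ cong (n *_) (ℕ.*-identityʳ n) ⟨
  n ^ 2   ≤⟨ ℕ.^-monoʳ-≤ n {2} {4} (s≤s (s≤s z≤n)) ⟩
  n ^ 4   ∎
  where open ≤-Reasoning

row·t-bounds : ∀ (A : Matrix h k) t → total t ≤ h * h → ∀ i → A i · t ≢ 0ℤ →
               0 < ∣ A i · t ∣ × ∣ A i · t ∣ ≤ h ^ 4 * maxAbs A
row·t-bounds {h} A t t≤ i Ai·t≢0 = ℕ.n≢0⇒n>0 (Ai·t≢0 ∘ ℤ.∣i∣≡0⇒i≡0) , (begin
  ∣ A i · t ∣          ≤⟨ ∣·∣≤total (A i) t (maxAbs A) (≤maxAbs A i) ⟩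
  total t * maxAbs A   ≤⟨ ℕ.*-monoˡ-≤ (maxAbs A) (ℕ.≤-trans t≤ (n*n≤n^4 h)) ⟩
  h ^ 4 * maxAbs A     ∎)
  where open ≤-Reasoning

·≢0⇒nonZero : ∀ (v : Vector ℤ n) t → v · t ≢ 0ℤ → NonZeroVector (+_ ∘ t)
·≢0⇒nonZero v t v·t≢0 t≡0 = v·t≢0 (∑-zero (λ p → v p ℤ.* + t p) λ p →
  trans (cong (v p ℤ.*_) (t≡0 p)) (ℤ.*-zeroʳ (v p)))

lemma1 : (h n : ℕ) (A : Matrix h (suc n)) →
    EachTwoRowsIndependent A →
    (h ≡ 1 → ∃₂ λ i j → A i j ≢ 0ℤ) →
    Σ[ T ∈ Matrix (suc n) (suc n) ]
    (NonSingular T ×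
    Injective _≡_ _≡_ (λ i → ∣ (A ⊗ T) i zero ∣) ×
    (∀ i → 0 < ∣ (A ⊗ T) i zero ∣ × ∣ (A ⊗ T) i zero ∣ ≤ h ^ 4 * maxAbs A))
lemma1 h n A indep nonZero =
  let t , t≤ , rows≢0 , injective = separatingVector A indep nonZero
      T , T-nonSingular , T-column = extendColumn (+_ ∘ t)
      -- For h = 0 the vector `t` is zero, so its being nonzero is derived from a given row `i`.
      column = λ i → ⊗-column t T (T-column (·≢0⇒nonZero (A i) t (rows≢0 i))) i
  in T , T-nonSingular
   , (λ {i} {j} eq → injective (trans (sym (column i)) (trans eq (column j))))
   , λ i → subst (λ c → 0 < c × c ≤ h ^ 4 * maxAbs A) (sym (column i)) (row·t-bounds A t t≤ i (rows≢0 i))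
  where
  ⊗-column : ∀ (t : Vector ℕ (suc n)) (T : Matrix (suc n) (suc n)) → (∀ p → T p zero ≡ + t p) → ∀ i → ∣ (A ⊗ T) i zero ∣ ≡ ∣ A i · t ∣
  ⊗-column t T T-column i = cong ∣_∣ (sum-cong-≗ +-*-semiring λ p → cong (A i p ℤ.*_) (T-column p))
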